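{- Let $q$ be a prime power. For every $m,k\ge2$ there exists a minimal $[2k+m-2,k]_{q^m/q}$ code.
   Context: Let $q$ be a prime power and $n,m,k$ positive integers. For $v\in\mathbb{F}_{q^m}^n$ and an ordered basis $\Gamma=(\gamma_1,\dots,\gamma_m)$ of $\mathbb{F}_{q^m}$ over $\mathbb{F}_q$, let $\Gamma(v)\in\mathbb{F}_q^{n\times m}$ be the matrix with $v_i=\sum_{j}\Gamma(v)_{ij}\gamma_j$. The rank support $\sigma^{\mathrm{rk}}(v)\subseteq\mathbb{F}_q^n$ is the column space of $\Gamma(v)$ (independent of $\Gamma$). An $[n,k]_{q^m/q}$ code is a $k$-dimensional $\mathbb{F}_{q^m}$-subspace $\mathcal{C}\subseteq\mathbb{F}_{q^m}^n$; it is minimal if for all $v,v'\in\mathcal{C}$, $\sigma^{\mathrm{rk}}(v')\subseteq\sigma^{\mathrm{rk}}(v)$ implies $v'=\alpha v$ for some $\alpha\in\mathbb{F}_{q^m}$. -}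

module Defs where

open import Level using (Level; _⊔_) renaming (suc to lsuc)
open import Algebra.Bundles using (CommutativeRing; Ring)
open import Algebra.Definitions using (Invertible)
open import Algebra.Module.Bundles using (LeftModule)
open import Algebra.Morphism.Structures using (IsRingHomomorphism)
import Algebra.Properties.CommutativeMonoid.Sum as Sum
open import Data.Fin.Base using (Fin)
open import Data.Nat.Base using (ℕ; _^_; _≤_)
open import Data.Nat.Primality using (Prime)
open import Data.Product.Base using (Σ-syntax; ∃-syntax; _×_; _,_; proj₁; proj₂)
open import Data.Vec.Functional using (Vector)
open import Function.Bundles using (Inverse)
open import Relation.Binary.Bundles using (Setoid)
open import Relation.Binary.PropositionalEquality.Core using (_≡_)
open import Relation.Binary.PropositionalEquality.Properties using (setoid)
open import Relation.Nullary.Negation.Core using (¬_)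
open import Relation.Unary using (Pred; U; _∈_; _⊆_)

private
  variable
    c ℓ c₁ ℓ₁ c₂ ℓ₂ v ℓv p : Level

IsPrimePower : ℕ → Set
IsPrimePower q = ∃[ p ] ∃[ e ] Prime p × 1 ≤ e × q ≡ p ^ e

-- The number of elements is counted up to the setoid equality.
HasCardinality : Setoid c ℓ → ℕ → Set (c ⊔ ℓ)
HasCardinality S n = Inverse S (setoid (Fin n))

record Field (c ℓ : Level) : Set (lsuc (c ⊔ ℓ)) where
  field
    commutativeRing : CommutativeRing c ℓ

  open CommutativeRing commutativeRing public

  field
    1≉0        : ¬ (1# ≈ 0#)
    invertible : ∀ x → ¬ (x ≈ 0#) → Invertible _≈_ 1# _*_ x

module _ {R : Ring c ℓ} (V : LeftModule R v ℓv) where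
  private module R = Ring R
  open LeftModule V
  open Sum +ᴹ-commutativeMonoid using (sum)

  linearCombination : ∀ {k} → Vector R.Carrier k → Vector Carrierᴹ k → Carrierᴹ
  linearCombination a b = sum (λ i → a i *ₗ b i)

  Span : ∀ {k} → Vector Carrierᴹ k → Pred Carrierᴹ (c ⊔ ℓv)
  Span b x = ∃[ a ] x ≈ᴹ linearCombination a b

  LinearlyIndependent : ∀ {k} → Vector Carrierᴹ k → Set (c ⊔ ℓ ⊔ ℓv)
  LinearlyIndependent b =
    ∀ a → linearCombination a b ≈ᴹ 0ᴹ → ∀ i → a i R.≈ R.0#

  record IsSubspace (P : Pred Carrierᴹ p) : Set (c ⊔ v ⊔ ℓv ⊔ p) where
    field
      resp-≈ᴹ   : ∀ {x y} → x ≈ᴹ y → x ∈ P → y ∈ P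
      0ᴹ-closed : 0ᴹ ∈ P
      +ᴹ-closed : ∀ {x y} → x ∈ P → y ∈ P → (x +ᴹ y) ∈ P
      *ₗ-closed : ∀ r {x} → x ∈ P → (r *ₗ x) ∈ P

  record IsBasis (P : Pred Carrierᴹ p) {k : ℕ} (b : Vector Carrierᴹ k)
         : Set (c ⊔ ℓ ⊔ v ⊔ ℓv ⊔ p) where
    field
      members     : ∀ i → b i ∈ P
      spanning    : P ⊆ Span b
      independent : LinearlyIndependent b

  HasDimension : Pred Carrierᴹ p → ℕ → Set (c ⊔ ℓ ⊔ v ⊔ ℓv ⊔ p)
  HasDimension P k = ∃[ b ] IsBasis P {k} b

-- Coordinate vectors Rⁿ with pointwise operations.
coordinateSpace : (R : Ring c ℓ) → ℕ → LeftModule R c ℓ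
coordinateSpace R n = record
  { Carrierᴹ = Vector Carrier n
  ; _≈ᴹ_ = λ x y → ∀ i → x i ≈ y i
  ; _+ᴹ_ = λ x y i → x i + y i
  ; _*ₗ_ = λ r x i → r * x i
  ; 0ᴹ = λ _ → 0#
  ; -ᴹ_ = λ x i → - x i
  ; isLeftModule = record
    { isLeftSemimodule = record
      { +ᴹ-isCommutativeMonoid = record
        { isMonoid = record
          { isSemigroup = record
            { isMagma = record
              { isEquivalence = record
                { refl = λ _ → refl
                ; sym = λ e i → sym (e i)
                ; trans = λ e f i → trans (e i) (f i)
                }
              ; ∙-cong = λ e f i → +-cong (e i) (f i)
              }
            ; assoc = λ x y z i → +-assoc (x i) (y i) (z i)
            }
          ; identity = (λ x i → +-identityˡ (x i)) , (λ x i → +-identityʳ (x i))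
          }
        ; comm = λ x y i → +-comm (x i) (y i)
        }
      ; isPreleftSemimodule = record
        { *ₗ-cong = λ e f i → *-cong e (f i)
        ; *ₗ-zeroˡ = λ x i → zeroˡ (x i)
        ; *ₗ-distribʳ = λ x r s i → distribʳ (x i) r s
        ; *ₗ-identityˡ = λ x i → *-identityˡ (x i)
        ; *ₗ-assoc = λ r s x i → *-assoc r s (x i)
        ; *ₗ-zeroʳ = λ r i → zeroʳ r
        ; *ₗ-distribˡ = λ r x y i → distribˡ r (x i) (y i)
        }
      }
    ; -ᴹ‿cong = λ e i → -‿cong (e i)
    ; -ᴹ‿inverse = (λ x i → -‿inverseˡ (x i)) , (λ x i → -‿inverseʳ (x i))
    }
  }
  where open Ring R

-- Injectivity of the embedding is automatic, as 1 ≉ 0 in the target.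
record Extension (F : Field c₁ ℓ₁) (K : Field c₂ ℓ₂)
       : Set (c₁ ⊔ ℓ₁ ⊔ c₂ ⊔ ℓ₂) where
  private
    module F = Field F
    module K = Field K
  field
    embed              : F.Carrier → K.Carrier
    isRingHomomorphism : IsRingHomomorphism F.rawRing K.rawRing embed

  open IsRingHomomorphism isRingHomomorphism public

module _ {F : Field c₁ ℓ₁} {K : Field c₂ ℓ₂} (E : Extension F K) where
  private
    module F = Field F
    module K = Field K
  open Extension E

  -- K as a vector space over F.
  overBase : LeftModule F.ring c₂ ℓ₂
  overBase = record
    { Carrierᴹ = K.Carrier
    ; _≈ᴹ_ = K._≈_
    ; _+ᴹ_ = K._+_
    ; _*ₗ_ = λ r x → embed r K.* x
    ; 0ᴹ = K.0#
    ; -ᴹ_ = K.-_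
    ; isLeftModule = record
      { isLeftSemimodule = record
        { +ᴹ-isCommutativeMonoid = K.+-isCommutativeMonoid
        ; isPreleftSemimodule = record
          { *ₗ-cong = λ e f → K.*-cong (⟦⟧-cong e) f
          ; *ₗ-zeroˡ = λ x → K.trans (K.*-congʳ 0#-homo) (K.zeroˡ x)
          ; *ₗ-distribʳ = λ x r s →
              K.trans (K.*-congʳ (+-homo r s)) (K.distribʳ x (embed r) (embed s))
          ; *ₗ-identityˡ = λ x → K.trans (K.*-congʳ 1#-homo) (K.*-identityˡ x)
          ; *ₗ-assoc = λ r s x →
              K.trans (K.*-congʳ (*-homo r s)) (K.*-assoc (embed r) (embed s) x)
          ; *ₗ-zeroʳ = λ r → K.zeroʳ (embed r)
          ; *ₗ-distribˡ = λ r → K.distribˡ (embed r)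
          }
        }
      ; -ᴹ‿cong = K.-‿cong
      ; -ᴹ‿inverse = K.-‿inverse
      }
    }

  OrderedBasis : ℕ → Set (c₁ ⊔ ℓ₁ ⊔ c₂ ⊔ ℓ₂)
  OrderedBasis m = Σ[ γ ∈ Vector K.Carrier m ] IsBasis overBase U γ

  -- If F has q elements, the extensions of F of degree m are exactly the
  -- fields with q ^ m elements containing F.
  HasDegree : ℕ → Set (c₁ ⊔ ℓ₁ ⊔ c₂ ⊔ ℓ₂)
  HasDegree m = HasDimension overBase U m

  -- Row i holds the coordinates of x i with respect to Γ; by linear
  -- independence of Γ these are the only possible ones up to ≈.
  expansion : ∀ {m n} → OrderedBasis m → Vector K.Carrier n →
              Fin n → Fin m → F.Carrier
  expansion (_ , isBasis) x i = proj₁ (IsBasis.spanning isBasis {x i} _)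

  rankSupport : ∀ {m n} → OrderedBasis m → Vector K.Carrier n →
                Pred (Vector F.Carrier n) (c₁ ⊔ ℓ₁)
  rankSupport {n = n} Γ x =
    Span (coordinateSpace F.ring n) (λ j i → expansion Γ x i j)

record Code (K : Field c ℓ) (n k : ℕ) : Set (lsuc (c ⊔ ℓ)) where
  Kⁿ : LeftModule (Field.ring K) c ℓ
  Kⁿ = coordinateSpace (Field.ring K) n

  open LeftModule Kⁿ using (Carrierᴹ)

  field
    codewords  : Pred Carrierᴹ (c ⊔ ℓ)
    isSubspace : IsSubspace Kⁿ codewords
    dimension  : HasDimension Kⁿ codewords k

-- The rank support does not depend on Γ, so it is immaterial whether one
-- fixes a basis or quantifies over all of them. The quantification is
-- vacuous if m is not the degree of E.
IsMinimal : {F : Field c₁ ℓ₁} {K : Field c₂ ℓ₂} (E : Extension F K) (m : ℕ) →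
            ∀ {n k} → Code K n k → Set (c₁ ⊔ ℓ₁ ⊔ c₂ ⊔ ℓ₂)
IsMinimal E m C =
  ∀ (Γ : OrderedBasis E m) x y → x ∈ codewords → y ∈ codewords →
  rankSupport E Γ y ⊆ rankSupport E Γ x →
  ∃[ α ] y ≈ᴹ (α *ₗ x)
  where
  open Code C
  open LeftModule Kⁿ using (_≈ᴹ_; _*ₗ_)

{-# OPTIONS --safe #-}

-- A code generated by columns u₁, …, uₙ ∈ Kᵏ fails to be minimal only if some
-- linearly independent x, y ∈ Kᵏ and some F-linear map g : K → K satisfy
-- g ⟨x, uᵢ⟩ = ⟨y, uᵢ⟩ for all i. Put Q = |K| = qᵐ. Rescaling x and y and
-- replacing (y, g) by (y - c x, g - c), one may assume that the first nonzero
-- coordinates of x and y are 1 and that g vanishes at the first basis vector;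
-- this leaves fewer than (Qᵏ / (Q - 1))² Q^(m-1) ≤ Qⁿ triples (x, y, g). A fixed
-- triple is satisfied by exactly one in Q of the vectors u ∈ Kᵏ, so the columns
-- can be chosen one after another, each dividing the number of triples
-- satisfied so far by at least Q, until no triple is left.

module Submission where

open import Defs
open import Algebra.Bundles using (CommutativeMonoid; Ring)
open import Algebra.Module.Bundles using (LeftModule)
import Algebra.Module.Construct.TensorUnit as TensorUnit
import Algebra.Properties.CommutativeMonoid.Sum as MonoidSum
import Algebra.Properties.CommutativeSemigroup as CommutativeSemigroupProperties
import Algebra.Properties.Ring as RingProperties
import Algebra.Properties.Semiring.Sum as SemiringSum
open import Data.Bool.Base using (if_then_else_)
open import Data.Fin.Base using (Fin; zero; suc; combine; funToFin; finToFun)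
open import Data.Fin.Permutation using (Permutation′)
open import Data.Fin.Properties using (suc-injective; nonZeroIndex; funToFin-finToFin; finToFun-funToFin; any?)
  renaming (_≟_ to _≟ᶠ_)
open import Data.List.Base using (List; []; _∷_; _++_; map; length; filter; tabulate; cartesianProduct)
open import Data.List.Membership.Propositional using (find) renaming (_∈_ to _∈ₗ_)
open import Data.List.Membership.Propositional.Properties using (∈-cartesianProduct⁺)
open import Data.List.Properties using (length-++; length-map; length-tabulate; length-filter)
open import Data.List.Relation.Unary.All using (All; []; _∷_)
import Data.List.Relation.Unary.All as All
open import Data.List.Relation.Unary.All.Properties using (filter⁺; filter⁻; all-filter)
open import Data.List.Relation.Unary.Any using (Any)
import Data.List.Relation.Unary.Any as Any
import Data.List.Relation.Unary.Any.Properties as AnyP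
open import Data.Nat.Base as ℕ using (ℕ; suc; _^_; z≤n; s≤s)
import Data.Nat.Properties as ℕ
open import Data.Product.Base using (Σ-syntax; ∃-syntax; _×_; _,_; proj₁; proj₂)
open import Data.Sum.Base using (inj₁; inj₂)
open import Data.Vec.Functional using (Vector; head; tail) renaming (_∷_ to _∷ᵛ_; [] to []ᵛ)
open import Data.Vec.Functional.Relation.Binary.Equality.Setoid using (≋-setoid)
open import Function.Base using (_∘_; id)
open import Function.Bundles using (Inverse; Injection)
open import Function.Construct.Composition using () renaming (inverse to _⨾_)
open import Function.Construct.Symmetry using () renaming (inverse to inverse⁻¹)
open import Function.Properties.Inverse using (Inverse⇒Injection)
open import Level using (Level; _⊔_)
open import Relation.Binary.Bundles using (Setoid)
open import Relation.Binary.PropositionalEquality as ≡ using (_≡_; _≢_)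
import Relation.Binary.Reasoning.Setoid as SetoidReasoning
open import Relation.Nullary.Decidable using (Dec; yes; no; does; ¬?; dec-true; dec-false; via-injection; decidable-stable)
open import Relation.Nullary.Negation using (¬_; contradiction)
open import Relation.Unary using (_∈_; _⊆_)

private
  variable
    a p c ℓ c₁ ℓ₁ c₂ ℓ₂ c₃ ℓ₃ : Level

-- Averaging, double counting and the numerical bound.

module Counting where
  open import Data.Nat.Base
  open import Data.Nat.Properties
  open import Data.Nat.Solver using (module +-*-Solver)
  open import Relation.Binary.PropositionalEquality using (refl; sym; trans; cong; cong₂; module ≡-Reasoning)
  open SemiringSum +-*-semiring using (sum; sum-cong-≗; ∑-distrib-+)

  indicator : {P : Set p} → Dec P → ℕ
  indicator P? = if does P? then 1 else 0

  indicator-⇔ : ∀ {q} {P : Set p} {Q : Set q} (P? : Dec P) (Q? : Dec Q) →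
                (P → Q) → (Q → P) → indicator P? ≡ indicator Q?
  indicator-⇔ (yes p) Q? f g rewrite dec-true Q? (f p) = refl
  indicator-⇔ (no ¬p) Q? f g rewrite dec-false Q? (¬p ∘ g) = refl

  length-filter-∷ : {A : Set a} {P : A → Set p} (P? : ∀ x → Dec (P x)) (x : A) (xs : List A) →
                    length (filter P? (x ∷ xs)) ≡ indicator (P? x) + length (filter P? xs)
  length-filter-∷ P? x xs with P? x
  ... | yes _ = refl
  ... | no _  = refl

  sum-zero : ∀ n → sum {n} (λ _ → 0) ≡ 0
  sum-zero n = SemiringSum.sum-replicate-zero +-*-semiring n

  -- By induction: of the head and the index found in the tail, the one with the smaller value
  -- works.
  below-average : ∀ {n} .{{_ : NonZero n}} (f : Vector ℕ n) → ∃[ i ] n * f i ≤ sum f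
  below-average {1}           f = zero , ≤-refl
  below-average {suc (suc n)} f with below-average (tail f)
  ... | j , avg with ≤-total (head f) (tail f j)
  ...   | inj₁ f₀≤fⱼ = zero , +-monoʳ-≤ (head f) (≤-trans (*-monoʳ-≤ (suc n) f₀≤fⱼ) avg)
  ...   | inj₂ fⱼ≤f₀ = suc j , +-mono-≤ fⱼ≤f₀ avg

  module _ {T : Set a} {N : ℕ} {Sat : T → Fin N → Set p} (sat? : ∀ t u → Dec (Sat t u)) where

    #sat : T → ℕ
    #sat t = sum (λ u → indicator (sat? t u))

    -- Both sides are `Q` times the number of pairs of a constraint in `B` and a point satisfying
    -- it; grouped by constraint, each one contributes `N`. The hypothesis is multiplied out to stay
    -- clear of division.
    double-count : ∀ {Q} {B : List T} → All (λ t → Q * #sat t ≡ N) B →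
                   Q * sum (λ u → length (filter (λ t → sat? t u) B)) ≡ length B * N
    double-count {Q} [] = trans (cong (Q *_) (sum-zero N)) (*-zeroʳ Q)
    double-count {Q} {t ∷ B} (t-sparse ∷ B-sparse) = begin
      Q * sum (λ u → length (filter (λ t → sat? t u) (t ∷ B)))
        ≡⟨ cong (Q *_) (sum-cong-≗ (λ u → length-filter-∷ (λ t → sat? t u) t B)) ⟩
      Q * sum (λ u → indicator (sat? t u) + length (filter (λ t → sat? t u) B))
        ≡⟨ cong (Q *_) (∑-distrib-+ (λ u → indicator (sat? t u)) _) ⟩
      Q * (#sat t + sum (λ u → length (filter (λ t → sat? t u) B)))
        ≡⟨ *-distribˡ-+ Q (#sat t) _ ⟩
      Q * #sat t + Q * sum (λ u → length (filter (λ t → sat? t u) B))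
        ≡⟨ cong₂ _+_ t-sparse (double-count {Q} B-sparse) ⟩
      N + length B * N ∎
      where open ≡-Reasoning

    -- Choosing each point below the average divides the number of surviving
    -- constraints by Q.
    avoid-all : ∀ .{{_ : NonZero N}} {Q} n {B : List T} → All (λ t → Q * #sat t ≡ N) B → length B < Q ^ n →
                Σ[ us ∈ Vector (Fin N) n ] All (λ t → ¬ (∀ i → Sat t (us i))) B
    avoid-all zero    {[]}    _ _ = []ᵛ , []
    avoid-all zero    {_ ∷ _} _ (s≤s ())
    avoid-all {Q} (suc n) {B} sparse B<Q^n
      with below-average (λ u → length (filter (λ t → sat? t u) B))
    -- A constraint that survives `u` is violated by a later point; one that does not survive is
    -- violated by `u` itself. `filter⁻` joins the two cases.
    ... | u , avg = u ∷ᵛ proj₁ rest , filter⁻ (λ t → sat? t u)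
          (All.map (λ ¬sat sat → ¬sat (sat ∘ suc)) (proj₂ rest))
          (All.map (λ ¬sat sat → ¬sat (sat zero)) (all-filter (λ t → ¬? (sat? t u)) B))
      where
      open ≤-Reasoning
      B′ = filter (λ t → sat? t u) B

      -- Averaging bounds `N * length B′` by the total number of satisfied pairs, and by double
      -- counting `Q` times that total is `length B * N`; then `N` cancels.
      fewer : Q * length B′ ≤ length B
      fewer = *-cancelˡ-≤ N (begin
        N * (Q * length B′)   ≡⟨ *-assoc N Q _ ⟨
        N * Q * length B′     ≡⟨ cong (_* length B′) (*-comm N Q) ⟩
        Q * N * length B′     ≡⟨ *-assoc Q N _ ⟩
        Q * (N * length B′)   ≤⟨ *-monoʳ-≤ Q avg ⟩
        Q * _                 ≡⟨ double-count {Q} sparse ⟩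
        length B * N          ≡⟨ *-comm (length B) N ⟩
        N * length B          ∎)

      rest = avoid-all {Q} n (filter⁺ (λ t → sat? t u) sparse)
               (*-cancelˡ-< Q _ _ (≤-<-trans fewer B<Q^n))

  sum-const : ∀ n a → sum {n} (λ _ → a) ≡ n * a
  sum-const zero    a = refl
  sum-const (suc n) a = cong (a +_) (sum-const n a)

  4≤^ : ∀ {q m} → 2 ≤ q → 2 ≤ m → 4 ≤ q ^ m
  4≤^ {q} {m} 2≤q 2≤m = begin
    2 ^ 2 ≤⟨ ^-monoʳ-≤ 2 2≤m ⟩
    2 ^ m ≤⟨ ^-monoˡ-≤ m 2≤q ⟩
    q ^ m ∎
    where open ≤-Reasoning

  ≤-square-pred : ∀ {Q} → 4 ≤ Q → Q ≤ pred Q * pred Q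
  ≤-square-pred {suc (suc Q)} (s≤s 3≤) = begin
    1 + suc Q         ≤⟨ +-monoˡ-≤ (suc Q) (s≤s z≤n) ⟩
    suc Q + suc Q     ≡⟨ cong (suc Q +_) (+-identityʳ (suc Q)) ⟨
    2 * suc Q         ≤⟨ *-monoˡ-≤ (suc Q) (≤-trans (n≤1+n 2) 3≤) ⟩
    suc Q * suc Q     ∎
    where open ≤-Reasoning

  -- Here `p` stands for the number of normalised vectors and the degree is `m + 2`, so `Q ^ suc m`
  -- counts the maps vanishing at the first basis vector. One factor `Q` of that power is traded for
  -- `(Q - 1)²`, and each `Q - 1` turns a `p` into less than `Q ^ k`.
  few-constraints : ∀ {p Q} k m → 4 ≤ Q → p * pred Q < Q ^ k →
                    p * (p * Q ^ suc m) < Q ^ (2 * k + suc (suc m) ∸ 2)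
  few-constraints {p} {Q} k m 4≤Q pQ′<Qᵏ = begin-strict
    p * (p * (Q * Q ^ m))                ≡⟨ solve 3 (λ p Q R → p :* (p :* (Q :* R)) := (p :* p) :* Q :* R) refl p Q (Q ^ m) ⟩
    p * p * Q * Q ^ m                    ≤⟨ *-monoˡ-≤ (Q ^ m) (*-monoʳ-≤ (p * p) (≤-square-pred 4≤Q)) ⟩
    p * p * (Q′ * Q′) * Q ^ m            ≡⟨ cong (_* Q ^ m) (solve 2 (λ p Q → p :* p :* (Q :* Q) := (p :* Q) :* (p :* Q)) refl p Q′) ⟩
    (p * Q′) * (p * Q′) * Q ^ m          <⟨ *-monoˡ-< (Q ^ m) {{m^n≢0 Q m}} (*-mono-< pQ′<Qᵏ pQ′<Qᵏ) ⟩
    Q ^ k * Q ^ k * Q ^ m                ≡⟨ cong (_* Q ^ m) (^-distribˡ-+-* Q k k) ⟨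
    Q ^ (k + k) * Q ^ m                  ≡⟨ ^-distribˡ-+-* Q (k + k) m ⟨
    Q ^ (k + k + m)                      ≡⟨ cong (Q ^_) exponent ⟩
    Q ^ (2 * k + suc (suc m) ∸ 2)        ∎
    where
    open ≤-Reasoning
    open +-*-Solver
    Q′ = pred Q
    instance
      Q≢0 : NonZero Q
      Q≢0 = >-nonZero (≤-trans (s≤s z≤n) 4≤Q)
    exponent : k + k + m ≡ 2 * k + suc (suc m) ∸ 2
    exponent = sym (trans (+-∸-assoc (2 * k) {suc (suc m)} (s≤s (s≤s z≤n)))
                        (cong (λ j → k + j + m) (+-identityʳ k)))

open Counting

-- Linear maps and linear combinations.

module _ (M : CommutativeMonoid c ℓ) where
  open CommutativeMonoid M
  open MonoidSum M

  sum-single : ∀ {n} (f : Vector Carrier n) j → (∀ i → i ≢ j → f i ≈ ε) → sum f ≈ f j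
  sum-single {suc n} f zero    f≈ε =
    trans (∙-congˡ (trans (sum-cong-≋ (λ i → f≈ε (suc i) λ ())) (sum-replicate-zero n))) (identityʳ _)
  sum-single {suc n} f (suc j) f≈ε =
    trans (∙-cong (f≈ε zero λ ()) (sum-single (f ∘ suc) j λ i i≢j → f≈ε (suc i) (i≢j ∘ suc-injective)))
          (identityˡ _)

module _ {R : Ring c ℓ} where

  record Linear (V : LeftModule R c₁ ℓ₁) (W : LeftModule R c₂ ℓ₂)
                (h : LeftModule.Carrierᴹ V → LeftModule.Carrierᴹ W)
         : Set (c ⊔ c₁ ⊔ ℓ₁ ⊔ c₂ ⊔ ℓ₂) where
    private
      module V = LeftModule V
      module W = LeftModule W
    field
      cong   : ∀ {y z} → y V.≈ᴹ z → h y W.≈ᴹ h z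
      +-homo : ∀ y z → h (y V.+ᴹ z) W.≈ᴹ h y W.+ᴹ h z
      *-homo : ∀ r z → h (r V.*ₗ z) W.≈ᴹ r W.*ₗ h z

    0-homo : h V.0ᴹ W.≈ᴹ W.0ᴹ
    0-homo = W.≈ᴹ-trans (cong (V.≈ᴹ-sym (V.*ₗ-zeroˡ V.0ᴹ)))
               (W.≈ᴹ-trans (*-homo (Ring.0# R) V.0ᴹ) (W.*ₗ-zeroˡ _))

    lc-homo : ∀ {k} (a : Vector (Ring.Carrier R) k) b →
              h (linearCombination V a b) W.≈ᴹ linearCombination W a (h ∘ b)
    lc-homo {ℕ.zero}  a b = 0-homo
    lc-homo {suc k} a b = W.≈ᴹ-trans (+-homo _ _)
      (W.+ᴹ-cong (*-homo _ _) (lc-homo (a ∘ suc) (b ∘ suc)))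

  _∘ᴸ_ : {V : LeftModule R c₁ ℓ₁} {W : LeftModule R c₂ ℓ₂} {X : LeftModule R c₃ ℓ₃} →
         ∀ {g h} → Linear W X g → Linear V W h → Linear V X (g ∘ h)
  _∘ᴸ_ {X = X} g h = record
    { cong   = g.cong ∘ h.cong
    ; +-homo = λ y z → ≈ᴹ-trans (g.cong (h.+-homo y z)) (g.+-homo _ _)
    ; *-homo = λ r z → ≈ᴹ-trans (g.cong (h.*-homo r z)) (g.*-homo r _)
    }
    where
    open LeftModule X
    module g = Linear g
    module h = Linear h

  tuple-linear : {V : LeftModule R c₁ ℓ₁} → ∀ {n} {h : Fin n → LeftModule.Carrierᴹ V → Ring.Carrier R} →
                 (∀ i → Linear V (TensorUnit.leftModule {R = R}) (h i)) →
                 Linear V (coordinateSpace R n) (λ z i → h i z)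
  tuple-linear h = record
    { cong   = λ e i → Linear.cong (h i) e
    ; +-homo = λ y z i → Linear.+-homo (h i) y z
    ; *-homo = λ r z i → Linear.*-homo (h i) r z
    }

  projection-linear : ∀ {n} i → Linear (coordinateSpace R n) (TensorUnit.leftModule {R = R}) (λ z → z i)
  projection-linear i = record
    { cong   = λ e → e i
    ; +-homo = λ _ _ → Ring.refl R
    ; *-homo = λ _ _ → Ring.refl R
    }

  module _ (V : LeftModule R c₁ ℓ₁) where
    private module R = Ring R
    open LeftModule V
    open MonoidSum +ᴹ-commutativeMonoid

    lc-cong : ∀ {k} {a a′ : Vector R.Carrier k} {b b′ : Vector Carrierᴹ k} →
              (∀ i → a i R.≈ a′ i) → (∀ i → b i ≈ᴹ b′ i) →
              linearCombination V a b ≈ᴹ linearCombination V a′ b′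
    lc-cong a≈a′ b≈b′ = sum-cong-≋ (λ i → *ₗ-cong (a≈a′ i) (b≈b′ i))

    lc-linear : ∀ {k} (b : Vector Carrierᴹ k) →
                Linear (coordinateSpace R k) V (λ a → linearCombination V a b)
    lc-linear b = record
      { cong   = λ e → lc-cong e (λ _ → ≈ᴹ-refl)
      ; +-homo = λ a a′ → ≈ᴹ-trans (sum-cong-≋ (λ i → *ₗ-distribʳ (b i) (a i) (a′ i))) (∑-distrib-+ (λ i → a i *ₗ b i) _)
      ; *-homo = scale b
      }
      where
      scale : ∀ {k} (b : Vector Carrierᴹ k) r (a : Vector R.Carrier k) →
              linearCombination V (λ i → r R.* a i) b ≈ᴹ r *ₗ linearCombination V a b
      scale {ℕ.zero}  b r a = ≈ᴹ-sym (*ₗ-zeroʳ r)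
      scale {suc k} b r a = ≈ᴹ-trans
        (+ᴹ-cong (*ₗ-assoc r (a zero) (b zero)) (scale (b ∘ suc) r (a ∘ suc)))
        (≈ᴹ-sym (*ₗ-distribˡ r _ _))

    Span-isSubspace : ∀ {k} (b : Vector Carrierᴹ k) → IsSubspace V (Span V b)
    Span-isSubspace b = record
      { resp-≈ᴹ   = λ { y≈z (a , y≈) → a , ≈ᴹ-trans (≈ᴹ-sym y≈z) y≈ }
      ; 0ᴹ-closed = (λ _ → R.0#) , ≈ᴹ-sym 0-homo
      ; +ᴹ-closed = λ { (a , y≈) (a′ , z≈) → (λ i → a i R.+ a′ i) ,
                        ≈ᴹ-trans (+ᴹ-cong y≈ z≈) (≈ᴹ-sym (+-homo a a′)) }
      ; *ₗ-closed = λ { r (a , y≈) → (λ i → r R.* a i) ,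
                        ≈ᴹ-trans (*ₗ-cong R.refl y≈) (≈ᴹ-sym (*-homo r a)) }
      }
      where open Linear (lc-linear b)

  unitVector : ∀ {k} → Fin k → Vector (Ring.Carrier R) k
  unitVector j i = if does (i ≟ᶠ j) then Ring.1# R else Ring.0# R

  module _ (V : LeftModule R c₁ ℓ₁) where
    private module R = Ring R
    open LeftModule V

    lc-unitVector : ∀ {k} (b : Vector Carrierᴹ k) j → linearCombination V (unitVector j) b ≈ᴹ b j
    lc-unitVector b j = ≈ᴹ-trans (sum-single +ᴹ-commutativeMonoid _ j off) on
      where
      off : ∀ i → i ≢ j → unitVector j i *ₗ b i ≈ᴹ 0ᴹ
      off i i≢j rewrite dec-false (i ≟ᶠ j) i≢j = *ₗ-zeroˡ (b i)

      on : unitVector j j *ₗ b j ≈ᴹ b j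
      on rewrite dec-true (j ≟ᶠ j) ≡.refl = *ₗ-identityˡ (b j)

    members∈Span : ∀ {k} (b : Vector Carrierᴹ k) j → b j ∈ Span V b
    members∈Span b j = unitVector j , ≈ᴹ-sym (lc-unitVector b j)

    coefficients-unique : ∀ {k} {b : Vector Carrierᴹ k} → LinearlyIndependent V b →
                          ∀ {a a′} → linearCombination V a b ≈ᴹ linearCombination V a′ b → ∀ i → a i R.≈ a′ i
    coefficients-unique {b = b} independent {a} {a′} eq i = x∙y⁻¹≈ε⇒x≈y (a i) (a′ i) (begin
      a i R.+ R.- a′ i            ≈⟨ R.+-congˡ (-1*x≈-x (a′ i)) ⟨
      a i R.+ R.- R.1# R.* a′ i   ≈⟨ independent d (≈ᴹ-trans (+-homo a _)
                                       (≈ᴹ-trans (+ᴹ-cong eq (*-homo (R.- R.1#) a′)) cancel)) i ⟩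
      R.0#                        ∎)
      where
      open SetoidReasoning R.setoid
      open RingProperties R using (-1*x≈-x; x∙y⁻¹≈ε⇒x≈y)
      open Linear (lc-linear V b)
      -- The difference is formed with the scalar -1, so that additivity and homogeneity of
      -- `linearCombination` apply to it directly.
      d = λ i → a i R.+ R.- R.1# R.* a′ i
      y = linearCombination V a′ b
      cancel : y +ᴹ (R.- R.1#) *ₗ y ≈ᴹ 0ᴹ
      cancel = ≈ᴹ-trans (+ᴹ-cong (≈ᴹ-sym (*ₗ-identityˡ y)) ≈ᴹ-refl)
        (≈ᴹ-trans (≈ᴹ-sym (*ₗ-distribʳ y R.1# (R.- R.1#)))
        (≈ᴹ-trans (*ₗ-cong (R.-‿inverseʳ R.1#) ≈ᴹ-refl) (*ₗ-zeroˡ y)))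

module _ {R : Ring c ℓ} {V : LeftModule R c₁ ℓ₁} {W : LeftModule R c₂ ℓ₂} where
  open LeftModule W

  +-linear : ∀ {g h} → Linear V W g → Linear V W h → Linear V W (λ z → g z +ᴹ h z)
  +-linear g h = record
    { cong   = λ e → +ᴹ-cong (g.cong e) (h.cong e)
    ; +-homo = λ y z → ≈ᴹ-trans (+ᴹ-cong (g.+-homo y z) (h.+-homo y z)) (interchange _ _ _ _)
    ; *-homo = λ r z → ≈ᴹ-trans (+ᴹ-cong (g.*-homo r z) (h.*-homo r z)) (≈ᴹ-sym (*ₗ-distribˡ r _ _))
    }
    where
    open CommutativeSemigroupProperties
      (CommutativeMonoid.commutativeSemigroup +ᴹ-commutativeMonoid) using (interchange)
    module g = Linear g
    module h = Linear h

  zero-linear : Linear V W (λ _ → 0ᴹ)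
  zero-linear = record
    { cong   = λ _ → ≈ᴹ-refl
    ; +-homo = λ _ _ → ≈ᴹ-sym (+ᴹ-identityˡ 0ᴹ)
    ; *-homo = λ r _ → ≈ᴹ-sym (*ₗ-zeroʳ r)
    }

-- Enumerations of finite setoids.

open SemiringSum ℕ.+-*-semiring using (sum; sum-cong-≗; ∑-comm; sum-permute)

funToFin-cong : ∀ {m n} {f g : Fin m → Fin n} → (∀ i → f i ≡ g i) → funToFin f ≡ funToFin g
funToFin-cong {ℕ.zero}  e = ≡.refl
funToFin-cong {suc m} e = ≡.cong₂ combine (e zero) (funToFin-cong (e ∘ suc))

vector-cardinality : {S : Setoid c ℓ} → ∀ {q} → HasCardinality S q → ∀ n → HasCardinality (≋-setoid S n) (q ^ n)
vector-cardinality {S = S} {q} card n = record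
  { to        = λ v → funToFin (to ∘ v)
  ; from      = λ i → from ∘ finToFun i
  ; to-cong   = λ e → funToFin-cong (to-cong ∘ e)
  ; from-cong = λ { ≡.refl _ → Setoid.refl S }
  ; inverse   = (λ {i} e → ≡.trans (funToFin-cong (inverseˡ ∘ e)) (funToFin-finToFin {n} {q} i))
              , (λ { {v} ≡.refl j → inverseʳ (finToFun-funToFin (to ∘ v) j) })
  }
  where open Inverse card

≟-from-cardinality : {S : Setoid c ℓ} → ∀ {q} → HasCardinality S q → ∀ x y → Dec (Setoid._≈_ S x y)
≟-from-cardinality card = via-injection (Inverse⇒Injection card) _≟ᶠ_

module _ {R : Ring c ℓ} (V : LeftModule R c₁ ℓ₁) where
  open LeftModule V

  translation : Carrierᴹ → Inverse ≈ᴹ-setoid ≈ᴹ-setoid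
  translation a = record
    { to        = _+ᴹ a
    ; from      = _+ᴹ (-ᴹ a)
    ; to-cong   = λ e → +ᴹ-cong e ≈ᴹ-refl
    ; from-cong = λ e → +ᴹ-cong e ≈ᴹ-refl
    ; inverse   = (λ e → ≈ᴹ-trans (+ᴹ-cong e ≈ᴹ-refl) (cancel _ (-ᴹ‿inverseˡ a)))
                , (λ e → ≈ᴹ-trans (+ᴹ-cong e ≈ᴹ-refl) (cancel _ (-ᴹ‿inverseʳ a)))
    }
    where
    cancel : ∀ y {b b′} → b +ᴹ b′ ≈ᴹ 0ᴹ → (y +ᴹ b) +ᴹ b′ ≈ᴹ y
    cancel y e = ≈ᴹ-trans (+ᴹ-assoc _ _ _) (≈ᴹ-trans (+ᴹ-cong ≈ᴹ-refl e) (+ᴹ-identityʳ y))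

module _ {S : Setoid c ℓ} {q : ℕ} (card : HasCardinality S q) where
  open Setoid S
  open Inverse card

  -- Only the index `to s` contributes, because `from` hits every class exactly once.
  count-≈ : (_≟_ : ∀ y z → Dec (y ≈ z)) → ∀ s → sum (λ t → indicator (from t ≟ s)) ≡ 1
  count-≈ _≟_ s = ≡.trans (sum-single ℕ.+-0-commutativeMonoid _ (to s) off) on
    where
    off : ∀ t → t ≢ to s → indicator (from t ≟ s) ≡ 0
    off t t≢ rewrite dec-false (from t ≟ s) (λ e → t≢ (≡.sym (inverseˡ (sym e)))) = ≡.refl
    on : indicator (from (to s) ≟ s) ≡ 1
    on rewrite dec-true (from (to s) ≟ s) (inverseʳ ≡.refl) = ≡.refl

-- Dot products and independent pairs over a field.

module FieldProperties (K : Field c ℓ) where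
  open Field K
  open RingProperties ring

  Kᵛ : ℕ → LeftModule ring c ℓ
  Kᵛ = coordinateSpace ring

  K¹ : LeftModule ring c ℓ
  K¹ = TensorUnit.leftModule

  inv : ∀ a → ¬ (a ≈ 0#) → Carrier
  inv a a≉0 = proj₁ (invertible a a≉0)

  inv-*ˡ : ∀ a (a≉0 : ¬ (a ≈ 0#)) → inv a a≉0 * a ≈ 1#
  inv-*ˡ a a≉0 = proj₁ (proj₂ (invertible a a≉0))

  inv-≉0 : ∀ a (a≉0 : ¬ (a ≈ 0#)) → ¬ (inv a a≉0 ≈ 0#)
  inv-≉0 a a≉0 e = 1≉0 (trans (sym (inv-*ˡ a a≉0)) (trans (*-congʳ e) (zeroˡ a)))

  inv-cancelˡ : ∀ a (a≉0 : ¬ (a ≈ 0#)) b → inv a a≉0 * (a * b) ≈ b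
  inv-cancelˡ a a≉0 b = trans (sym (*-assoc _ a b)) (trans (*-congʳ (inv-*ˡ a a≉0)) (*-identityˡ b))

  *-cancelˡ-≉0 : ∀ {a} → ¬ (a ≈ 0#) → ∀ {b b′} → a * b ≈ a * b′ → b ≈ b′
  *-cancelˡ-≉0 {a} a≉0 e =
    trans (sym (inv-cancelˡ a a≉0 _)) (trans (*-congˡ e) (inv-cancelˡ a a≉0 _))

  infix 8 _∙_
  _∙_ : ∀ {k} → Vector Carrier k → Vector Carrier k → Carrier
  x ∙ u = linearCombination K¹ x u

  ∙-comm : ∀ {k} (x u : Vector Carrier k) → x ∙ u ≈ u ∙ x
  ∙-comm x u = MonoidSum.sum-cong-≋ +-commutativeMonoid (λ i → *-comm (x i) (u i))

  ∙-linearˡ : ∀ {k} (u : Vector Carrier k) → Linear (Kᵛ k) K¹ (_∙ u)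
  ∙-linearˡ = lc-linear K¹

  ∙-linearʳ : ∀ {k} (x : Vector Carrier k) → Linear (Kᵛ k) K¹ (x ∙_)
  ∙-linearʳ x = record
    { cong   = λ e → trans (∙-comm x _) (trans (cong e) (∙-comm _ x))
    ; +-homo = λ u w → trans (∙-comm x _) (trans (+-homo u w) (+-cong (∙-comm u x) (∙-comm w x)))
    ; *-homo = λ r u → trans (∙-comm x _) (trans (*-homo r u) (*-congˡ (∙-comm u x)))
    }
    where open Linear (∙-linearˡ x)

  -- A nonzero 2×2 minor of the matrix with rows `x` and `y`. Over a finite field this form is
  -- decidable, and the minor is what `dual-vector` divides by.
  Independent : ∀ {k} → Vector Carrier k → Vector Carrier k → Set ℓ
  Independent x y = ∃[ i ] ∃[ j ] ¬ (x i * y j ≈ x j * y i)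

  -- Cramer's rule: with `w = (xᵢ eⱼ - xⱼ eᵢ) / minor`, pairing `z` with `w` gives the minor of `x`
  -- and `z` divided by that of `x` and `y`.
  dual-vector : ∀ {k} (x y : Vector Carrier k) → Independent x y →
                ∃[ w ] x ∙ w ≈ 0# × y ∙ w ≈ 1#
  dual-vector {k} x y (i , j , xᵢyⱼ≉xⱼyᵢ) = w , x∙w≈0 , y∙w≈1
    where
    open SetoidReasoning setoid
    minor = x i * y j + - x j * y i

    minor≉0 : ¬ (minor ≈ 0#)
    minor≉0 e = xᵢyⱼ≉xⱼyᵢ (x∙y⁻¹≈ε⇒x≈y _ _ (trans (+-congˡ (-‿distribˡ-* (x j) (y i))) e))

    d = inv minor minor≉0
    open LeftModule (Kᵛ k) using (_+ᴹ_; _*ₗ_)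
    w = d *ₗ ((x i *ₗ unitVector {R = ring} j) +ᴹ ((- x j) *ₗ unitVector {R = ring} i))

    ∙w : ∀ z → z ∙ w ≈ d * (x i * z j + - x j * z i)
    ∙w z = begin
      z ∙ w ≈⟨ ∙-comm z w ⟩
      w ∙ z ≈⟨ *-homo d _ ⟩
      d * _ ≈⟨ *-congˡ (+-homo _ _) ⟩
      d * _ ≈⟨ *-congˡ (+-cong (*-homo (x i) _) (*-homo (- x j) _)) ⟩
      d * _ ≈⟨ *-congˡ (+-cong (*-congˡ (lc-unitVector K¹ z j)) (*-congˡ (lc-unitVector K¹ z i))) ⟩
      d * (x i * z j + - x j * z i) ∎
      where open Linear (∙-linearˡ z)

    x∙w≈0 : x ∙ w ≈ 0#
    x∙w≈0 = begin
      x ∙ w                           ≈⟨ ∙w x ⟩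
      d * (x i * x j + - x j * x i)   ≈⟨ *-congˡ (+-cong (*-comm (x i) (x j)) (sym (-‿distribˡ-* (x j) (x i)))) ⟩
      d * (x j * x i + - (x j * x i)) ≈⟨ *-congˡ (-‿inverseʳ _) ⟩
      d * 0#                          ≈⟨ zeroʳ d ⟩
      0#                              ∎

    y∙w≈1 : y ∙ w ≈ 1#
    y∙w≈1 = trans (∙w y) (inv-*ˡ minor minor≉0)

  -- Normalised vectors and the density of a constraint over a finite field.

  module _ {Q : ℕ} (card : HasCardinality setoid Q) where

    _≟_ : ∀ a b → Dec (a ≈ b)
    _≟_ = ≟-from-cardinality card

    independent? : ∀ {k} (x y : Vector Carrier k) → Dec (Independent x y)
    independent? x y = any? λ i → any? λ j → ¬? ((x i * y j) ≟ (x j * y i))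

    vectors↔ : ∀ k → HasCardinality (≋-setoid setoid k) (Q ^ k)
    vectors↔ = vector-cardinality card

    vector : ∀ {k} → Fin (Q ^ k) → Vector Carrier k
    vector {k} = Inverse.from (vectors↔ k)

    vectors : ∀ k → List (Vector Carrier k)
    vectors k = tabulate (vector {k})

    ∈-vectors : ∀ {k} (x : Vector Carrier k) → Any (λ u → ∀ i → x i ≈ u i) (vectors k)
    ∈-vectors {k} x = AnyP.tabulate⁺ (to x) (λ i → sym (inverseʳ ≡.refl i))
      where open Inverse (vectors↔ k)

    -- Vectors with first nonzero coordinate 1: one representative for each point of the projective
    -- space of `Kᵏ`.
    monics : ∀ k → List (Vector Carrier k)
    monics ℕ.zero    = []
    monics (suc k) = map (0# ∷ᵛ_) (monics k) ++ map (1# ∷ᵛ_) (vectors k)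

    -- The exact count is `(Q ^ k - 1) / (Q - 1)`; multiplied out, its strict upper bound needs
    -- neither division nor subtraction of powers.
    length-monics : ∀ k → length (monics k) ℕ.* ℕ.pred Q ℕ.< Q ^ k
    length-monics ℕ.zero    = s≤s z≤n
    length-monics (suc k) = begin-strict
      length (monics (suc k)) ℕ.* Q′
        ≡⟨ ≡.cong (ℕ._* Q′) (≡.trans (length-++ (map _ (monics k)))
            (≡.cong₂ ℕ._+_ (length-map _ (monics k))
              (≡.trans (length-map _ (vectors k)) (length-tabulate (vector {k}))))) ⟩
      (length (monics k) ℕ.+ Q ^ k) ℕ.* Q′      ≡⟨ ℕ.*-distribʳ-+ Q′ (length (monics k)) _ ⟩
      length (monics k) ℕ.* Q′ ℕ.+ Q ^ k ℕ.* Q′ <⟨ ℕ.+-monoˡ-< _ (length-monics k) ⟩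
      Q ^ k ℕ.+ Q ^ k ℕ.* Q′                    ≡⟨ ℕ.*-suc (Q ^ k) Q′ ⟨
      Q ^ k ℕ.* suc Q′                          ≡⟨ ≡.cong (Q ^ k ℕ.*_) (ℕ.suc-pred Q {{nonZeroIndex (Inverse.to card 0#)}}) ⟩
      Q ^ k ℕ.* Q                               ≡⟨ ℕ.*-comm (Q ^ k) Q ⟩
      Q ^ suc k                                 ∎
      where
      open ℕ.≤-Reasoning
      Q′ = ℕ.pred Q

    -- The recursion looks for the first nonzero coordinate and divides by it. The given `i` need
    -- not be that coordinate; it guarantees that the search succeeds.
    monic-multiple : ∀ {k} (x : Vector Carrier k) i → ¬ (x i ≈ 0#) →
                     ∃[ a ] ¬ (a ≈ 0#) × Any (λ u → ∀ i → a * x i ≈ u i) (monics k)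
    monic-multiple {suc k} x i xᵢ≉0 with head x ≟ 0#
    ... | no x₀≉0 = inv _ x₀≉0 , inv-≉0 _ x₀≉0 ,
      AnyP.++⁺ʳ _ (AnyP.map⁺ (Any.map
        (λ { e zero → inv-*ˡ _ x₀≉0 ; e (suc j) → e j }) (∈-vectors _)))
    monic-multiple {suc k} x zero    x₀≉0 | yes x₀≈0 = contradiction x₀≈0 x₀≉0
    monic-multiple {suc k} x (suc i) xᵢ≉0 | yes x₀≈0 with monic-multiple (tail x) i xᵢ≉0
    ... | a , a≉0 , a*x∈monics = a , a≉0 ,
      AnyP.++⁺ˡ (AnyP.map⁺ (Any.map
        (λ { e zero → trans (*-congˡ x₀≈0) (zeroʳ a) ; e (suc j) → e j }) a*x∈monics))

    module _ {k : ℕ} (x y : Vector Carrier k) {g : Carrier → Carrier} (g-cong : ∀ {a b} → a ≈ b → g a ≈ g b) where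

      interpolates? : ∀ u → Dec (g (x ∙ u) ≈ y ∙ u)
      interpolates? u = g (x ∙ u) ≟ (y ∙ u)

      module _ (x-y-independent : Independent x y) where
        open Inverse card using (from)
        open LeftModule (Kᵛ k) using (_+ᴹ_; _*ₗ_)
        w = proj₁ (dual-vector x y x-y-independent)
        x∙w≈0 = proj₁ (proj₂ (dual-vector x y x-y-independent))
        y∙w≈1 = proj₂ (proj₂ (dual-vector x y x-y-independent))

        -- Translation by `from t *ₗ w`, transported to the indices of the enumerated vectors so
        -- that sums over them can be permuted.
        shift : Fin Q → Permutation′ (Q ^ k)
        shift t = (inverse⁻¹ (vectors↔ k) ⨾ translation (Kᵛ k) (from t *ₗ w)) ⨾ vectors↔ k

        -- Moving `u` along `w` by the scalar `gap u`, and by no other, makes it satisfy the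
        -- constraint: `g (x ∙ u)` stays fixed while `y ∙ u` grows by that scalar.
        gap : Vector Carrier k → Carrier
        gap u = g (x ∙ u) - y ∙ u

        ∙-shift : ∀ z {r} → z ∙ w ≈ r → ∀ t u → z ∙ vector (Inverse.to (shift t) u) ≈ z ∙ vector u + from t * r
        ∙-shift z {r} z∙w≈r t u = begin
          z ∙ vector (Inverse.to (shift t) u)   ≈⟨ cong (Inverse.inverseʳ (vectors↔ k) ≡.refl) ⟩
          z ∙ (vector u +ᴹ (from t *ₗ w))       ≈⟨ +-homo _ _ ⟩
          z ∙ vector u + z ∙ (from t *ₗ w)      ≈⟨ +-congˡ (*-homo (from t) w) ⟩
          z ∙ vector u + from t * z ∙ w         ≈⟨ +-congˡ (*-congˡ z∙w≈r) ⟩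
          z ∙ vector u + from t * r             ∎
          where
          open SetoidReasoning setoid
          open Linear (∙-linearʳ z)

        gx-shift : ∀ t u → g (x ∙ vector (Inverse.to (shift t) u)) ≈ g (x ∙ vector u)
        gx-shift t u = g-cong (trans (∙-shift x x∙w≈0 t u) (trans (+-congˡ (zeroʳ _)) (+-identityʳ _)))

        y-shift : ∀ t u → y ∙ vector (Inverse.to (shift t) u) ≈ y ∙ vector u + from t
        y-shift t u = trans (∙-shift y y∙w≈1 t u) (+-congˡ (*-identityʳ _))

        hit→ : ∀ t u → g (x ∙ vector (Inverse.to (shift t) u)) ≈ y ∙ vector (Inverse.to (shift t) u) →
               from t ≈ gap (vector u)
        hit→ t u e = sym (begin
          g (x ∙ vector u) - y ∙ vector u        ≈⟨ +-congʳ (trans (sym (gx-shift t u)) (trans e (y-shift t u))) ⟩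
          y ∙ vector u + from t - y ∙ vector u   ≈⟨ +-congʳ (+-comm _ _) ⟩
          from t + y ∙ vector u - y ∙ vector u   ≈⟨ //-rightDividesʳ _ _ ⟩
          from t                                 ∎)
          where open SetoidReasoning setoid

        hit← : ∀ t u → from t ≈ gap (vector u) →
               g (x ∙ vector (Inverse.to (shift t) u)) ≈ y ∙ vector (Inverse.to (shift t) u)
        hit← t u e = trans (gx-shift t u) (sym (begin
          y ∙ vector (Inverse.to (shift t) u)             ≈⟨ y-shift t u ⟩
          y ∙ vector u + from t                           ≈⟨ +-congˡ e ⟩
          y ∙ vector u + (g (x ∙ vector u) - y ∙ vector u) ≈⟨ +-comm _ _ ⟩
          g (x ∙ vector u) - y ∙ vector u + y ∙ vector u  ≈⟨ //-rightDividesˡ _ _ ⟩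
          g (x ∙ vector u)                                ∎))
          where open SetoidReasoning setoid

        -- Along every line in the direction of the dual vector w, x ∙ u is
        -- constant whereas y ∙ u takes each value exactly once.
        interpolated-fraction :
          Q ℕ.* sum (λ u → indicator (interpolates? (vector u))) ≡ Q ^ k
        interpolated-fraction = begin
          Q ℕ.* sum (λ u → indicator (interpolates? (vector u)))
            ≡⟨ sum-const Q _ ⟨
          sum (λ (t : Fin Q) → sum (λ u → indicator (interpolates? (vector u))))
            ≡⟨ sum-cong-≗ (λ t → sum-permute (λ u → indicator (interpolates? (vector u))) (shift t)) ⟩
          sum (λ t → sum (λ u → indicator (interpolates? (vector (Inverse.to (shift t) u)))))
            ≡⟨ sum-cong-≗ (λ t → sum-cong-≗ (λ u →
                 indicator-⇔ (interpolates? _) (from t ≟ gap (vector u)) (hit→ t u) (hit← t u))) ⟩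
          sum (λ t → sum (λ u → indicator (from t ≟ gap (vector {k} u))))
            ≡⟨ ∑-comm {Q} {Q ^ k} (λ t u → indicator (from t ≟ gap (vector {k} u))) ⟩
          sum (λ u → sum (λ t → indicator (from t ≟ gap (vector {k} u))))
            ≡⟨ sum-cong-≗ {Q ^ k} (λ u → count-≈ card _≟_ (gap (vector u))) ⟩
          sum {Q ^ k} (λ _ → 1)
            ≡⟨ sum-const (Q ^ k) 1 ⟩
          Q ^ k ℕ.* 1
            ≡⟨ ℕ.*-identityʳ (Q ^ k) ⟩
          Q ^ k ∎
          where open ≡.≡-Reasoning

length-cartesianProduct : ∀ {a b} {A : Set a} {B : Set b} (xs : List A) (ys : List B) →
                          length (cartesianProduct xs ys) ≡ length xs ℕ.* length ys
length-cartesianProduct []       ys = ≡.refl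
length-cartesianProduct (x ∷ xs) ys = ≡.trans (length-++ (map (x ,_) ys))
  (≡.cong₂ ℕ._+_ (length-map (x ,_) ys) (length-cartesianProduct xs ys))

cardinality≥2 : (F : Field c ℓ) → ∀ {q} → HasCardinality (Field.setoid F) q → 2 ℕ.≤ q
cardinality≥2 F {0} card with () ← Inverse.to card (Field.0# F)
cardinality≥2 F {1} card = contradiction (injective (all-equal _ _)) (Field.1≉0 F)
  where
  open Injection (Inverse⇒Injection card) using (injective)
  all-equal : (i j : Fin 1) → i ≡ j
  all-equal zero zero = ≡.refl
cardinality≥2 F {suc (suc q)} card = s≤s (s≤s z≤n)

-- Independent pairs under rescaling and shearing.

module _ (K : Field c ℓ) where
  open Field K
  open FieldProperties K
  open RingProperties ring

  independent-sym : ∀ {k} {x y : Vector Carrier k} → Independent x y → Independent y x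
  independent-sym (i , j , ≉) = i , j ,
    λ e → ≉ (trans (*-comm _ _) (trans (sym e) (*-comm _ _)))

  independent-scaleˡ : ∀ {k a} {x x′ y : Vector Carrier k} → ¬ (a ≈ 0#) → (∀ i → a * x i ≈ x′ i) →
                       Independent x y → Independent x′ y
  independent-scaleˡ a≉0 ax≈x′ (i , j , ≉) = i , j , λ e → ≉ (*-cancelˡ-≉0 a≉0
    (trans (sym (*-assoc _ _ _)) (trans (*-congʳ (ax≈x′ i))
      (trans e (trans (*-congʳ (sym (ax≈x′ j))) (*-assoc _ _ _))))))

  -- The minors do not change: the product of `a`, `x i` and `x j` occurs on both sides and cancels.
  independent-shear : ∀ {k} {x y : Vector Carrier k} a →
                      Independent x y → Independent x (λ i → y i + a * x i)
  independent-shear {x = x} {y} a (i , j , ≉) = i , j , λ e → ≉ (+-cancelʳ _ _ _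
    (trans (sym (distribˡ (x i) (y j) (a * x j)))
      (trans e (trans (distribˡ (x j) (y i) (a * x i)) (+-congˡ (x∙yz≈z∙yx (x j) a (x i)))))))
    where open CommutativeSemigroupProperties *-commutativeSemigroup using (x∙yz≈z∙yx)

  independent⇒≉0 : (∀ a b → Dec (a ≈ b)) → ∀ {k} {x y : Vector Carrier k} →
                   Independent x y → ∃[ i ] ¬ (x i ≈ 0#)
  independent⇒≉0 _≟_ {x = x} (i , j , ≉) with x i ≟ 0#
  ... | no  xᵢ≉0 = i , xᵢ≉0
  ... | yes xᵢ≈0 = j , λ xⱼ≈0 → ≉ (trans (trans (*-congʳ xᵢ≈0) (zeroˡ _))
                                     (sym (trans (*-congʳ xⱼ≈0) (zeroˡ _))))

  -- The factor is `y i / x i`. Dependence only denies that a minor is nonzero, so decidable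
  -- equality is used to recover `x i * y j ≈ x j * y i`.
  dependent⇒proportional : (∀ a b → Dec (a ≈ b)) → ∀ {k} {x y : Vector Carrier k} i → ¬ (x i ≈ 0#) → ¬ Independent x y →
                           ∃[ α ] (∀ j → y j ≈ α * x j)
  dependent⇒proportional _≟_ {x = x} {y} i xᵢ≉0 dependent = y i * x⁻¹ , λ j → *-cancelˡ-≉0 xᵢ≉0 (begin
      x i * y j                 ≈⟨ decidable-stable (_ ≟ _) (λ ≉ → dependent (i , j , ≉)) ⟩
      x j * y i                 ≈⟨ *-comm (x j) (y i) ⟩
      y i * x j                 ≈⟨ *-congˡ (inv-cancelˡ (x i) xᵢ≉0 (x j)) ⟨
      y i * (x⁻¹ * (x i * x j)) ≈⟨ *-assoc _ _ _ ⟨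
      y i * x⁻¹ * (x i * x j)   ≈⟨ x∙yz≈y∙xz _ _ _ ⟩
      x i * (y i * x⁻¹ * x j)   ∎)
    where
    open SetoidReasoning setoid
    open CommutativeSemigroupProperties *-commutativeSemigroup using (x∙yz≈y∙xz)
    x⁻¹ = inv (x i) xᵢ≉0

  -- This lets `g` be multiplied by, composed with, or changed by adding a scalar of `K` while
  -- remaining `F`-linear.
  scalar-linear : ∀ {c₁ ℓ₁} {F : Field c₁ ℓ₁} (E : Extension F K) a → Linear (overBase E) (overBase E) (a *_)
  scalar-linear E a = record
    { cong   = *-congˡ
    ; +-homo = distribˡ a
    ; *-homo = λ r z → x∙yz≈y∙xz a (Extension.embed E r) z
    }
    where open CommutativeSemigroupProperties *-commutativeSemigroup using (x∙yz≈y∙xz)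

  -- If the rank support of one codeword contains that of another, then an
  -- F-linear g maps the entries of the first to those of the second.
  Separating : ∀ {c₁ ℓ₁} {F : Field c₁ ℓ₁} (E : Extension F K) {k n} → Vector (Vector Carrier k) n → Set (c ⊔ ℓ ⊔ c₁)
  Separating E u = ∀ {x y g} → Linear (overBase E) (overBase E) g → Independent x y →
                   ¬ (∀ i → g (x ∙ u i) ≈ y ∙ u i)

-- Coordinates and `F`-linear maps on the extension field.

module _ {F : Field c₁ ℓ₁} {K : Field c₂ ℓ₂} (E : Extension F K) where
  private
    module F = Field F
    module K = Field K
    V = overBase E

  module Coordinates {m : ℕ} (Γ : OrderedBasis E m) where
    open IsBasis (proj₂ Γ)
    γ = proj₁ Γ

    -- Agrees by definition with a row of `expansion`, so results about it apply to rank supports.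
    coordinates : K.Carrier → Vector F.Carrier m
    coordinates z = proj₁ (spanning {z} _)

    expand : ∀ z → z K.≈ linearCombination V (coordinates z) γ
    expand z = proj₂ (spanning {z} _)

    coordinates-unique : ∀ {z a} → z K.≈ linearCombination V a γ → ∀ i → coordinates z i F.≈ a i
    coordinates-unique {z} z≈ = coefficients-unique V independent (K.trans (K.sym (expand z)) z≈)

    -- `spanning` merely chooses coefficients; that the choice respects equality and is linear
    -- follows from their uniqueness.
    coordinates-linear : Linear V (coordinateSpace F.ring m) coordinates
    coordinates-linear = record
      { cong   = λ {y} {z} y≈z → coordinates-unique (K.trans y≈z (expand z))
      ; +-homo = λ y z → coordinates-unique
          (K.trans (K.+-cong (expand y) (expand z)) (K.sym (+-homo _ _)))
      ; *-homo = λ r z → coordinates-unique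
          (K.trans (K.*-congˡ (expand z)) (K.sym (*-homo r _)))
      }
      where open Linear (lc-linear V γ)

    extension-cardinality : ∀ {q} → HasCardinality F.setoid q → HasCardinality K.setoid (q ^ m)
    extension-cardinality card = coordinates↔ ⨾ vector-cardinality card m
      where
      coordinates↔ : Inverse K.setoid (≋-setoid F.setoid m)
      coordinates↔ = record
        { to        = coordinates
        ; from      = λ a → linearCombination V a γ
        ; to-cong   = Linear.cong coordinates-linear
        ; from-cong = Linear.cong (lc-linear V γ)
        ; inverse   = coordinates-unique
                    , λ {z} e → K.trans (Linear.cong (lc-linear V γ) e) (K.sym (expand z))
        }

    -- The `F`-linear map sending `γ j` to `φ j`; in this way tuples of values enumerate all
    -- `F`-linear maps from `K` to itself.
    interpolate : Vector K.Carrier m → K.Carrier → K.Carrier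
    interpolate φ z = linearCombination V (coordinates z) φ

    interpolate-linear : ∀ φ → Linear V V (interpolate φ)
    interpolate-linear φ = lc-linear V φ ∘ᴸ coordinates-linear

    interpolate-basis : ∀ {g φ} → Linear V V g → (∀ j → g (γ j) K.≈ φ j) → ∀ z → interpolate φ z K.≈ g z
    interpolate-basis {g} {φ} g-linear gγ≈φ z = K.sym
      (K.trans (g.cong (expand z)) (K.trans (g.lc-homo (coordinates z) γ) (lc-cong V (λ _ → F.refl) gγ≈φ)))
      where module g = Linear g-linear

    -- A zero basis vector would make a unit vector the coefficients of a vanishing combination. The
    -- normalisation of `g` divides by `γ zero`.
    basis-≉0 : ∀ j → ¬ (γ j K.≈ K.0#)
    basis-≉0 j γⱼ≈0 = F.1≉0 (F.trans (F.sym one)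
      (independent (unitVector {R = F.ring} j) (K.trans (lc-unitVector V γ j) γⱼ≈0) j))
      where
      one : unitVector {R = F.ring} j j F.≈ F.1#
      one rewrite dec-true (j ≟ᶠ j) ≡.refl = F.refl

  -- Choosing the columns.

  module Construction {q m′ k : ℕ} (cardF : HasCardinality F.setoid q) (Γ : OrderedBasis E (suc m′)) where
    open K hiding (zero)
    open RingProperties ring
    open FieldProperties K
    open Coordinates Γ

    Q = q ^ suc m′

    card : HasCardinality setoid Q
    card = extension-cardinality cardF

    -- (x , y , φ) encodes the triple (x, y, g) in which g sends the first basis
    -- vector to 0 and the others to φ.
    Constraint : Set c₂
    Constraint = Vector Carrier k × Vector Carrier k × Vector Carrier m′

    -- Dependent pairs are kept, so that the length is a plain product; they are filtered out before
    -- the points are chosen.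
    candidates : List Constraint
    candidates = cartesianProduct (monics card k) (cartesianProduct (monics card k) (vectors card m′))

    length-candidates : length candidates ≡ length (monics card k) ℕ.* (length (monics card k) ℕ.* Q ^ m′)
    length-candidates = ≡.trans (length-cartesianProduct (monics card k) _)
      (≡.cong (length (monics card k) ℕ.*_) (≡.trans (length-cartesianProduct (monics card k) _)
        (≡.cong (length (monics card k) ℕ.*_) (length-tabulate (vector card {m′})))))

    Sat : Constraint → Fin (Q ^ k) → Set ℓ₂
    Sat (x , y , φ) u = interpolate (0# ∷ᵛ φ) (x ∙ vector card u) ≈ y ∙ vector card u

    sat? : ∀ t u → Dec (Sat t u)
    sat? (x , y , φ) u = interpolates? card x y (Linear.cong (interpolate-linear (0# ∷ᵛ φ))) (vector card u)

    IndependentPair : Constraint → Set ℓ₂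
    IndependentPair (x , y , _) = Independent x y

    independentPair? : ∀ t → Dec (IndependentPair t)
    independentPair? (x , y , _) = independent? card x y

    Avoiding : ∀ {n} → Vector (Fin (Q ^ k)) n → Set (c₂ ⊔ ℓ₂)
    Avoiding us = All (λ t → IndependentPair t → ¬ (∀ i → Sat t (us i))) candidates

    module _ {n : ℕ} (few : length candidates ℕ.< Q ^ n) where

      avoiding-points : Σ[ us ∈ Vector (Fin (Q ^ k)) n ] Avoiding us
      -- Independent candidates are handled by `avoid-all`; for dependent ones the claim is vacuous.
      avoiding-points = proj₁ avoided , filter⁻ independentPair?
          (All.map (λ ¬sat _ → ¬sat) (proj₂ avoided))
          (All.map (λ ¬ind ind → contradiction ind ¬ind) (all-filter (¬? ∘ independentPair?) candidates))
        where
        sparse : All (λ t → Q ℕ.* #sat sat? t ≡ Q ^ k) (filter independentPair? candidates)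
        sparse = All.map (λ { {x , y , φ} ind → interpolated-fraction card x y (Linear.cong (interpolate-linear (0# ∷ᵛ φ))) ind })
                   (all-filter independentPair? candidates)
        avoided = avoid-all sat? {{nonZeroIndex (Inverse.to (vectors↔ card k) (λ _ → 0#))}} {Q} n sparse
                    (ℕ.≤-<-trans (length-filter independentPair? candidates) few)

    module _ {n : ℕ} (us : Vector (Fin (Q ^ k)) n) (avoiding : Avoiding us) where

      points : Vector (Vector Carrier k) n
      points i = vector card (us i)

      open SetoidReasoning setoid

      -- As `g` vanishes at `γ zero`, it is the interpolation of `0# ∷ᵛ φ` for an enumerated `φ`, so
      -- the triple is one of the candidates.
      monic-pair-separates : ∀ {x y g} → x ∈ₗ monics card k → y ∈ₗ monics card k → Linear V V g → g (γ zero) ≈ 0# →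
                             Independent x y → ¬ (∀ i → g (x ∙ points i) ≈ y ∙ points i)
      monic-pair-separates {x} {y} {g} x∈ y∈ g-linear gγ₀≈0 ind gx≈y =
        let φ , φ∈ , gγ≈φ = find (∈-vectors card (λ j → g (γ (suc j)))) in
        All.lookup avoiding (∈-cartesianProduct⁺ x∈ (∈-cartesianProduct⁺ y∈ φ∈)) ind
          (λ i → trans (interpolate-basis {φ = 0# ∷ᵛ φ} g-linear (λ { zero → gγ₀≈0 ; (suc j) → gγ≈φ j }) _) (gx≈y i))

      -- Passing from `(y , g)` to `(b y , b g)` makes `y` monic and keeps `g` zero at `γ zero`.
      monic-separates-normalised : ∀ {x y g} → x ∈ₗ monics card k → Linear V V g → g (γ zero) ≈ 0# →
                                   Independent x y → ¬ (∀ i → g (x ∙ points i) ≈ y ∙ points i)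
      monic-separates-normalised {x} {y} {g} x∈ g-linear gγ₀≈0 ind gx≈y =
        let j , yⱼ≉0 = independent⇒≉0 K (_≟_ card) (independent-sym K ind)
            b , b≉0 , by∈monics = monic-multiple card y j yⱼ≉0
            y′ , y′∈ , by≈y′ = find by∈monics
        in
        monic-pair-separates x∈ y′∈ (scalar-linear K E b ∘ᴸ g-linear)
          (trans (*-congˡ gγ₀≈0) (zeroʳ b))
          (independent-sym K (independent-scaleˡ K b≉0 by≈y′ (independent-sym K ind)))
          λ i → begin
            b * g (x ∙ points i)          ≈⟨ *-congˡ (gx≈y i) ⟩
            b * y ∙ points i              ≈⟨ Linear.*-homo (∙-linearˡ (points i)) b y ⟨
            (λ j → b * y j) ∙ points i    ≈⟨ Linear.cong (∙-linearˡ (points i)) by≈y′ ⟩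
            y′ ∙ points i                 ∎

      -- Passing from `(y , g)` to `(y + d x , g + d)` makes the map vanish at `γ zero`. This comes
      -- before `y` is rescaled, since it changes `y`.
      monic-separates : ∀ {x y g} → x ∈ₗ monics card k → Linear V V g →
                        Independent x y → ¬ (∀ i → g (x ∙ points i) ≈ y ∙ points i)
      monic-separates {x} {y} {g} x∈ g-linear ind gx≈y =
        monic-separates-normalised x∈ (+-linear g-linear (scalar-linear K E d)) vanishes
          (independent-shear K d ind)
          λ i → begin
            g (x ∙ points i) + d * x ∙ points i         ≈⟨ +-congʳ (gx≈y i) ⟩
            y ∙ points i + d * x ∙ points i             ≈⟨ +-congˡ (Linear.*-homo (∙-linearˡ (points i)) d x) ⟨
            y ∙ points i + (λ j → d * x j) ∙ points i   ≈⟨ Linear.+-homo (∙-linearˡ (points i)) y _ ⟨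
            (λ j → y j + d * x j) ∙ points i            ∎
        where
        γ₀ = γ zero
        γ₀≉0 = basis-≉0 zero
        -- The solution of `g γ₀ + d γ₀ = 0`.
        d = - (g γ₀ * inv γ₀ γ₀≉0)

        vanishes : g γ₀ + d * γ₀ ≈ 0#
        vanishes = begin
          g γ₀ + d * γ₀                           ≈⟨ +-congˡ (-‿distribˡ-* _ γ₀) ⟨
          g γ₀ + - (g γ₀ * inv γ₀ γ₀≉0 * γ₀)      ≈⟨ +-congˡ (-‿cong (*-assoc _ _ γ₀)) ⟩
          g γ₀ + - (g γ₀ * (inv γ₀ γ₀≉0 * γ₀))    ≈⟨ +-congˡ (-‿cong (*-congˡ (inv-*ˡ γ₀ γ₀≉0))) ⟩
          g γ₀ + - (g γ₀ * 1#)                    ≈⟨ +-congˡ (-‿cong (*-identityʳ _)) ⟩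
          g γ₀ + - g γ₀                           ≈⟨ -‿inverseʳ _ ⟩
          0#            ∎

      -- Rescaling `x` by `a` is compensated by composing `g` with multiplication by the inverse of
      -- `a`.
      points-separate : Separating K E points
      points-separate {x} {y} {g} g-linear ind gx≈y =
        let j , xⱼ≉0 = independent⇒≉0 K (_≟_ card) ind
            a , a≉0 , ax∈monics = monic-multiple card x j xⱼ≉0
            x′ , x′∈ , ax≈x′ = find ax∈monics
        in
        monic-separates x′∈ (g-linear ∘ᴸ scalar-linear K E (inv a a≉0))
          (independent-scaleˡ K a≉0 ax≈x′ ind)
          λ i → trans (Linear.cong g-linear (begin
            inv a a≉0 * x′ ∙ points i                ≈⟨ *-congˡ (Linear.cong (∙-linearˡ (points i)) ax≈x′) ⟨
            inv a a≉0 * (λ j → a * x j) ∙ points i   ≈⟨ *-congˡ (Linear.*-homo (∙-linearˡ (points i)) a x) ⟩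
            inv a a≉0 * (a * x ∙ points i)           ≈⟨ inv-cancelˡ a a≉0 _ ⟩
            x ∙ points i                             ∎)) (gx≈y i)

  -- From rank supports to linear maps.

  -- Inclusion writes each column of the expansion of `y` as a combination of columns of that of
  -- `x`. The coefficients form a matrix `A`, and `g` is the map with matrix `A` in the basis `γ`.
  rankSupport-⊆⇒linear : ∀ {m n} (Γ : OrderedBasis E m) (x y : Vector K.Carrier n) →
                         rankSupport E Γ y ⊆ rankSupport E Γ x →
                         ∃[ g ] Linear V V g × (∀ i → g (x i) K.≈ y i)
  rankSupport-⊆⇒linear {m} {n} Γ x y ⊆x = _ , g-linear , λ i →
      K.trans (Linear.cong (lc-linear V γ) (λ j → F.sym (column j i))) (K.sym (expand (y i)))
    where
    open Coordinates Γ
    open FieldProperties F using (_∙_; ∙-linearʳ)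

    columns : Vector K.Carrier n → Vector (Vector F.Carrier n) m
    columns z j i = coordinates (z i) j

    y∈x : ∀ j → columns y j ∈ rankSupport E Γ x
    y∈x j = ⊆x (members∈Span (coordinateSpace F.ring n) (columns y) j)

    A : Fin m → Vector F.Carrier m
    A j = proj₁ (y∈x j)

    column : ∀ j i → coordinates (y i) j F.≈ A j ∙ coordinates (x i)
    column j i = F.trans (proj₂ (y∈x j) i) (Linear.lc-homo (projection-linear {R = F.ring} i) (A j) (columns x))

    g-linear : Linear V V (λ z → linearCombination V (λ j → A j ∙ coordinates z) γ)
    g-linear = lc-linear V γ ∘ᴸ tuple-linear (λ j → ∙-linearʳ (A j) ∘ᴸ coordinates-linear)

  -- The code generated by separating columns.

  module SeparatingCode {n k : ℕ} (_≟_ : ∀ a b → Dec (a K.≈ b)) (u : Vector (Vector K.Carrier (suc (suc k))) n)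
                        (separating : Separating K E u) where
    open K hiding (zero)
    open FieldProperties K hiding (_≟_)
    Kⁿ = coordinateSpace ring n

    -- Rows of the generator matrix with columns `u i`, so the codeword of a message `x` has entries
    -- `x ∙ u i`.
    rows : Vector (Vector Carrier n) (suc (suc k))
    rows l i = u i l

    lc-rows : ∀ x i → linearCombination Kⁿ x rows i ≈ x ∙ u i
    lc-rows x i = Linear.lc-homo (projection-linear {R = ring} i) x rows

    another : (l : Fin (suc (suc k))) → ∃[ l′ ] l ≢ l′
    another zero    = suc zero , λ ()
    another (suc l) = zero , λ ()

    -- If `x` gave the zero codeword with `x l` nonzero, then the unit vector at another index and
    -- `x` would be independent, and the zero map would carry the codeword of the first to that of
    -- the second, against separation.
    rows-independent : LinearlyIndependent Kⁿ rows
    rows-independent x x·rows≈0 l = decidable-stable (x l ≟ 0#) λ xₗ≉0 →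
      separating {x = e′} {y = x} zero-linear (l′ , l , λ e → xₗ≉0 (begin
          x l           ≈⟨ *-identityˡ (x l) ⟨
          1# * x l      ≈⟨ *-congʳ on ⟨
          e′ l′ * x l   ≈⟨ e ⟩
          e′ l * x l′   ≈⟨ *-congʳ off ⟩
          0# * x l′     ≈⟨ zeroˡ (x l′) ⟩
          0#            ∎))
        (λ i → trans (sym (x·rows≈0 i)) (lc-rows x i))
      where
      open SetoidReasoning setoid
      l′ = proj₁ (another l)
      e′ = unitVector {R = ring} l′
      on : e′ l′ ≈ 1#
      on rewrite dec-true (l′ ≟ᶠ l′) ≡.refl = refl
      off : e′ l ≈ 0#
      off rewrite dec-false (l ≟ᶠ l′) (proj₂ (another l)) = refl

    code : Code K n (suc (suc k))
    code = record
      { codewords  = Span Kⁿ rows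
      ; isSubspace = Span-isSubspace Kⁿ rows
      ; dimension  = rows , record
        { members     = members∈Span Kⁿ rows
        ; spanning    = id
        ; independent = rows-independent
        }
      }

    code-isMinimal : ∀ m → IsMinimal E m code
    code-isMinimal m Γ v w (x , v≈x) (y , w≈y) w⊆v with any? (λ i → ¬? (x i ≟ 0#))
    -- The linear map obtained from the inclusion carries `v` to `w`, so separation makes the
    -- messages dependent, and `y` is a multiple of the nonzero `x`.
    ... | yes (i , xᵢ≉0) = proj₁ prop , λ j → begin
          w j                                                   ≈⟨ w≈y j ⟩
          linearCombination Kⁿ y rows j                         ≈⟨ cong (proj₂ prop) j ⟩
          linearCombination Kⁿ (λ i → proj₁ prop * x i) rows j  ≈⟨ *-homo (proj₁ prop) x j ⟩
          proj₁ prop * linearCombination Kⁿ x rows j            ≈⟨ *-congˡ (v≈x j) ⟨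
          proj₁ prop * v j                                      ∎
      where
      open SetoidReasoning setoid
      open Linear (lc-linear Kⁿ rows)
      dependent : ¬ Independent x y
      dependent ind = separating (proj₁ (proj₂ g)) ind λ i → begin
          proj₁ g (x ∙ u i) ≈⟨ Linear.cong (proj₁ (proj₂ g)) (trans (v≈x i) (lc-rows x i)) ⟨
          proj₁ g (v i)     ≈⟨ proj₂ (proj₂ g) i ⟩
          w i               ≈⟨ trans (w≈y i) (lc-rows y i) ⟩
          y ∙ u i           ∎
        where g = rankSupport-⊆⇒linear Γ v w w⊆v
      prop = dependent⇒proportional K _≟_ i xᵢ≉0 dependent
    -- Here `v` is zero, and linearity forces `w` to be zero as well.
    ... | no x≈0 = 0# , λ i → begin
          w i           ≈⟨ proj₂ (proj₂ g) i ⟨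
          proj₁ g (v i) ≈⟨ Linear.cong (proj₁ (proj₂ g)) (v≈0 i) ⟩
          proj₁ g 0#    ≈⟨ Linear.0-homo (proj₁ (proj₂ g)) ⟩
          0#            ≈⟨ zeroˡ (v i) ⟨
          0# * v i      ∎
      where
      open SetoidReasoning setoid
      open Linear (lc-linear Kⁿ rows)
      g = rankSupport-⊆⇒linear Γ v w w⊆v
      v≈0 : ∀ i → v i ≈ 0#
      v≈0 i = trans (v≈x i) (trans (cong (λ l → decidable-stable (x l ≟ 0#) (λ xₗ≉0 → x≈0 (l , xₗ≉0))) i) (0-homo i))

-- Assembling the parameters.

open import Data.Nat.Base using (_+_; _*_; _∸_; _≤_)

corollary6p11 : ∀ {c₁ ℓ₁ c₂ ℓ₂} (q m k : ℕ) → IsPrimePower q → 2 ≤ m → 2 ≤ k →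
    (F : Field c₁ ℓ₁) (K : Field c₂ ℓ₂) → HasCardinality (Field.setoid F) q →
    (E : Extension F K) → HasDegree E m →
    Σ[ C ∈ Code K (2 * k + m ∸ 2) k ] IsMinimal E m C
corollary6p11 q m@(suc (suc m″)) k@(suc (suc k″)) _ 2≤m@(s≤s (s≤s _)) (s≤s (s≤s _)) F K card E Γ = code , code-isMinimal m
  where
  -- A proof of `HasDegree` is by definition an ordered basis. It serves to choose the columns;
  -- minimality is then shown for every basis.
  open Construction E {k = k} card Γ using (length-candidates; avoiding-points; points; points-separate)
  cardK = Coordinates.extension-cardinality E Γ card
  open FieldProperties K using (monics; length-monics)
  n = 2 * k + m ∸ 2
  us = avoiding-points {n} (≡.subst (ℕ._< (q ^ m) ^ n) (≡.sym length-candidates)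
         (few-constraints {length (monics cardK k)} k m″ (4≤^ (cardinality≥2 F card) 2≤m) (length-monics cardK k)))
  open SeparatingCode E (≟-from-cardinality cardK) (points (proj₁ us) (proj₂ us))
         (points-separate (proj₁ us) (proj₂ us))
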